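{- Let $n\ge 3$ be an integer and let $K=\{123,132\}\{231,312\}$. The number of equivalence classes of $S_n$ under $K$-equivalence is $3\cdot 2^{n-3}+n-2$.
   Context: Permutations in $S_n$ are written as words $\pi_1\pi_2\cdots\pi_n$ in one-line notation. The order permutation of a word $u$ of $c$ distinct positive integers is the unique $\sigma\in S_c$ with $\sigma_i<\sigma_j$ iff $u_i<u_j$. A replacement partition $K$ of $S_c$ is a set partition of $S_c$; it is denoted by listing its parts with the one-element parts (and outer brackets) omitted, so here $K$ is the set partition of $S_3$ whose only parts of size greater than one are $\{123,132\}$ and $\{231,312\}$. The $K$-equivalence on $S_n$ is the equivalence relation generated by: $\phi\equiv\psi$ whenever $\phi=aub$ and $\psi=avb$ (concatenations) for some possibly empty words $a,b$ and words $u,v$ of length $c$ (so $u,v$ occupy the same $c$ consecutive positions) such that the order permutations of $u$ and $v$ lie in the same part of $K$. All equivalence classes are counted, including one-element classes. -}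

module Defs where

open import Data.Fin using (Fin)
open import Data.List using (List; []; _∷_; _++_; map; upTo)
open import Data.List.Membership.Propositional using (_∈_)
open import Data.List.Relation.Binary.Permutation.Propositional using (_↭_)
open import Data.List.Relation.Unary.Any using (Any)
open import Data.Nat using (ℕ; suc; _<_)
open import Data.Product using (Σ; _×_; proj₁)
open import Data.Sum using (_⊎_)
open import Data.Vec using (Vec; toList; lookup; []; _∷_)
open import Function.Bundles using (_⇔_; Bijection)
open import Level using (Level)
open import Relation.Binary.Bundles using (Setoid)
open import Relation.Binary.Construct.Closure.Equivalence using (EqClosure)
import Relation.Binary.Construct.Closure.Equivalence as EqC
import Relation.Binary.Construct.On as On
open import Relation.Binary.PropositionalEquality using (_≡_)
import Relation.Binary.PropositionalEquality as ≡

-- One-line notation: the word uses each of the letters 1, …, n exactly once.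
IsPermutation : ∀ {n} → Vec ℕ n → Set
IsPermutation {n} w = toList w ↭ map suc (upTo n)

S : ℕ → Set
S n = Σ (Vec ℕ n) IsPermutation

-- Given as a relation; on words with distinct letters it is functional in u.
_IsOrderPermutationOf_ : ∀ {c} → Vec ℕ c → Vec ℕ c → Set
σ IsOrderPermutationOf u =
  IsPermutation σ ×
  (∀ i j → (lookup σ i < lookup σ j) ⇔ (lookup u i < lookup u j))

-- A set partition of S c, given by its (pairwise disjoint) parts with
-- one-element parts omitted.
ReplacementPartition : ℕ → Set
ReplacementPartition c = List (List (Vec ℕ c))

-- The first alternative accounts for the omitted one-element parts.
SamePart : ∀ {c} → ReplacementPartition c → Vec ℕ c → Vec ℕ c → Set
SamePart K σ τ = σ ≡ τ ⊎ Any (λ part → σ ∈ part × τ ∈ part) K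

-- Both words are required to lie in S n, so that every intermediate word in
-- the generated equivalence is again a permutation.
record Replacement {c} (K : ReplacementPartition c) {n} (φ ψ : Vec ℕ n) : Set where
  field
    φ-perm : IsPermutation φ
    ψ-perm : IsPermutation ψ
    a b    : List ℕ
    u v    : Vec ℕ c
    φ≡aub  : toList φ ≡ a ++ toList u ++ b
    ψ≡avb  : toList ψ ≡ a ++ toList v ++ b
    σ τ    : Vec ℕ c
    σ-ord  : σ IsOrderPermutationOf u
    τ-ord  : τ IsOrderPermutationOf v
    στ∈K   : SamePart K σ τ

-- Comparing underlying words makes the membership proofs in S n immaterial.
K-setoid : ∀ {c} → ReplacementPartition c → ℕ → Setoid _ _
K-setoid K n = record
  { Carrier       = S n
  ; _≈_           = λ φ ψ → EqClosure (Replacement K) (proj₁ φ) (proj₁ ψ)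
  ; isEquivalence = On.isEquivalence proj₁ (EqC.isEquivalence (Replacement K))
  }

HasNumberOfClasses : ∀ {a ℓ : Level} → Setoid a ℓ → ℕ → Set _
HasNumberOfClasses X k = Bijection X (≡.setoid (Fin k))

K₀ : ReplacementPartition 3
K₀ = ((1 ∷ 2 ∷ 3 ∷ []) ∷ (1 ∷ 3 ∷ 2 ∷ []) ∷ [])
   ∷ ((2 ∷ 3 ∷ 1 ∷ []) ∷ (3 ∷ 1 ∷ 2 ∷ []) ∷ [])
   ∷ []

{-# OPTIONS --safe #-}
module Submission where

-- Write a permutation as P 1 R. The class of the permutation is governed by the
-- prefix P.
--
-- Reduction. Behind a letter smaller than all that follow, the letters can be
-- permuted freely, by an insertion sort (permute). An ascent in P can be pushed to
-- the right until its smaller letter jumps over the 1, which shortens P; hence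
-- every permutation is equivalent to some D 1 Q with D decreasing (reduce), and Q
-- may be put in any order. If D contains neither 2 nor 3, these two letters stand
-- behind the 1, and with their help D shrinks to its greatest letter (collapse).
-- So every class contains a word D 1 Q in which D is decreasing and either contains
-- 2 or 3, or is empty, or is a single letter e ≥ 4.
--
-- Invariant. Let the defect of P be the number of non-inversions of the subword
-- formed by the letters of P together with 1 and 2. If the defect is 0, keyOf
-- records that 2 is in P, whether 3 is, and which letters ≥ 4 are; if it is 1 and 3
-- is in P, keyOf records that and the letters ≥ 4 of P; in all other cases it
-- records the greatest letter of P. This is invariant under the replacements
-- (key-step): a swap inside P has at least two non-inversions on both sides and
-- keeps the letters; a rotation inside P keeps the letters and the defect; a
-- rotation y z 1 ↦ z 1 y with y = 2 trades the non-inversion of 2 and z for that of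
-- 1 and 2, and with y > 2 it stays in the last case and keeps the maximum, as
-- z > y; replacements behind the 1, or swaps starting at the 1, do not change P. On
-- the words D 1 Q above the key determines D (normal-injective), so equivalence is
-- equality of keys (key-injective).
--
-- Count. With n = 3 + m there are 3 ways to have 2 or 3 in D and 2 ^ m choices of
-- the letters ≥ 4, and otherwise D is empty or one of m letters. All of these keys
-- occur (key-surjective), which gives 3 * 2 ^ m + (m + 1) classes.

open import Data.Bool using (Bool; true; false; if_then_else_)
open import Data.Fin using (Fin; zero; suc; toℕ)
open import Data.Fin.Patterns using (0F; 1F; 2F)
open import Data.Fin.Properties using (toℕ<n; toℕ-fromℕ<; toℕ-injective; +↔⊎; *↔×; 2↔Bool)
open import Data.List using (List; []; _∷_; _++_; map; foldr; upTo; downFrom; length)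
open import Data.List.Membership.Propositional using (_∈_; _∉_)
open import Data.List.Membership.Propositional.Properties
  using (∈-++⁺ˡ; ∈-++⁺ʳ; ∈-++⁻; ∈-∃++; ∈-map⁺; ∈-upTo⁺; ∈-upTo⁻)
open import Data.List.Properties
  using (map-++; ++-assoc; ++-identityʳ; reverse-upTo; length-map; length-upTo)
open import Data.List.Relation.Binary.Permutation.Propositional
  using (_↭_; ↭-refl; ↭-sym; ↭-trans; ↭-reflexive; ↭-prep; ↭-swap; ↭⇒↭ₛ)
open import Data.List.Relation.Binary.Permutation.Propositional.Properties
  using (All-resp-↭; ∈-resp-↭; shift; drop-mid; drop-∷; ++⁺ˡ; ++⁺ʳ; ++-comm; map⁺; ↭-length; ↭-reverse)
import Data.List.Relation.Binary.Permutation.Setoid.Properties as Permutationₛ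
open import Data.List.Relation.Binary.Subset.Propositional using (_⊆_)
open import Data.List.Relation.Unary.All as All using (All; []; _∷_)
import Data.List.Relation.Unary.All.Properties as All
open import Data.List.Relation.Unary.AllPairs using (AllPairs; []; _∷_)
import Data.List.Relation.Unary.AllPairs.Properties as AllPairs
open import Data.List.Relation.Unary.Any using (here; there)
open import Data.List.Relation.Unary.Unique.Propositional using (Unique)
import Data.List.Relation.Unary.Unique.Propositional.Properties as Unique
open import Data.Nat
  using (ℕ; zero; suc; _+_; _*_; _∸_; _^_; _⊔_; _<_; _>_; _≤_; _≥_; z≤n; s≤s; _<?_; _≟_)
open import Data.List.Membership.DecPropositional _≟_ using (_∈?_)
open import Data.Nat.DivMod using (_mod_; m<n⇒m%n≡m; m%n<n)
open import Data.Nat.ListAction using (sum)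
open import Data.Nat.ListAction.Properties using (sum-↭; sum-++)
open import Data.Nat.Properties
open import Data.Nat.Tactic.RingSolver using (solve-∀)
open import Data.Product using (∃; ∃₂; _×_; _,_; proj₁; proj₂)
open import Data.Product.Function.NonDependent.Propositional using (_×-↔_)
open import Data.Sum using (_⊎_; inj₁; inj₂; [_,_]′)
open import Data.Sum.Function.Propositional using (_⊎-↔_)
open import Data.Vec using (Vec; []; _∷_; toList; lookup; fromList; tabulate; uncons)
open import Data.Vec.Properties
  using (tabulate∘lookup; lookup∘tabulate; tabulate-cong; toList∘fromList; length-toList; toList-injective;
         cast-is-id; ∷-injective)
open import Function using (_∘_; _⇔_; mk⇔; Equivalence; _↔_; mk↔ₛ′; Bijection)
open import Function.Construct.Composition using (_⇔-∘_; bijection)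
open import Function.Construct.Symmetry using (⇔-sym)
import Function.Properties.Inverse as Inverse
open import Level using (0ℓ)
open import Relation.Binary using (Rel; Asymmetric; tri<; tri≈; tri>)
import Relation.Binary.Construct.Closure.Equivalence as EqC
open EqC using (EqClosure)
open import Relation.Binary.Construct.Closure.ReflexiveTransitive using (ε; _◅_; _◅◅_)
open import Relation.Binary.Construct.Closure.Symmetric using (SymClosure; fwd; bwd)
open import Relation.Binary.PropositionalEquality as ≡
  using (_≡_; _≢_; refl; sym; trans; cong; cong₂; subst; subst₂; module ≡-Reasoning)
import Relation.Binary.Reasoning.Setoid as SetoidReasoning
open import Relation.Nullary using (Dec; does; yes; no; ¬_; contradiction)
open import Relation.Nullary.Decidable using (does-⇔; dec-true; dec-false)
open import Defs

------------------------------------------------------------------------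
-- Moves on words of naturals

-- The two kinds of replacement on the first three letters of a word, each in
-- one direction: swap turns the pattern 123 into 132, rotate turns 231 into 312.
data Move : List ℕ → List ℕ → Set where
  swap   : ∀ {x y z} b → x < y → y < z → Move (x ∷ y ∷ z ∷ b) (x ∷ z ∷ y ∷ b)
  rotate : ∀ {x y z} b → x < y → y < z → Move (y ∷ z ∷ x ∷ b) (z ∷ x ∷ y ∷ b)

-- A move carried out on any three consecutive letters.
data Step : List ℕ → List ℕ → Set where
  at : ∀ a {u v} → Move u v → Step (a ++ u) (a ++ v)

infix 4 _~_

-- The K-equivalence for the partition K₀, on arbitrary words of naturals.
-- Passing to lists makes prefixes and suffixes easy to handle; a word equivalent
-- to a permutation is again a permutation, by ~⇒↭.
_~_ : List ℕ → List ℕ → Set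
_~_ = EqClosure Step

~-sym : ∀ {u v} → u ~ v → v ~ u
~-sym = EqC.symmetric Step

swap~ : ∀ {x y z b} → x < y → y < z → x ∷ y ∷ z ∷ b ~ x ∷ z ∷ y ∷ b
swap~ p q = EqC.return (at [] (swap _ p q))

rotate~ : ∀ {x y z b} → x < y → y < z → y ∷ z ∷ x ∷ b ~ z ∷ x ∷ y ∷ b
rotate~ p q = EqC.return (at [] (rotate _ p q))

cons~ : ∀ h {u v} → u ~ v → h ∷ u ~ h ∷ v
cons~ h = EqC.gmap (h ∷_) λ { (at a m) → at (h ∷ a) m }

prefix~ : ∀ a {u v} → u ~ v → a ++ u ~ a ++ v
prefix~ []      r = r
prefix~ (h ∷ a) r = cons~ h (prefix~ a r)

~⇒↭ : ∀ {u v} → u ~ v → u ↭ v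
~⇒↭ = EqC.fold (record { refl = ↭-refl ; sym = ↭-sym ; trans = ↭-trans }) step⇒↭
  where
  step⇒↭ : ∀ {u v} → Step u v → u ↭ v
  step⇒↭ (at a (swap b _ _))   = ++⁺ˡ a (↭-prep _ (↭-swap _ _ ↭-refl))
  step⇒↭ (at a (rotate b _ _)) = ++⁺ˡ a (↭-trans (↭-swap _ _ ↭-refl) (↭-prep _ (↭-swap _ _ ↭-refl)))

module ~-Reasoning = SetoidReasoning (EqC.setoid Step)

------------------------------------------------------------------------
-- Lists: distinct entries, cancellation, strictly ordered lists

Unique-resp-↭ : {u v : List ℕ} → u ↭ v → Unique u → Unique v
Unique-resp-↭ p = Permutationₛ.Unique-resp-↭ (≡.setoid ℕ) (↭⇒↭ₛ p)

Unique-++∷⇒∉ˡ : ∀ u {x v} → Unique (u ++ x ∷ v) → x ∉ u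
Unique-++∷⇒∉ˡ u uniq = Unique.Unique[x∷xs]⇒x∉xs (Unique-resp-↭ (shift _ u _) uniq) ∘ ∈-++⁺ˡ

Unique-++⁻ʳ : ∀ u {v : List ℕ} → Unique (u ++ v) → Unique v
Unique-++⁻ʳ []      uniq       = uniq
Unique-++⁻ʳ (_ ∷ u) (_ ∷ uniq) = Unique-++⁻ʳ u uniq

dropPrefix : ∀ a {u v : List ℕ} → a ++ u ↭ a ++ v → u ↭ v
dropPrefix []      p = p
dropPrefix (_ ∷ a) p = dropPrefix a (drop-∷ p)

dropSuffix : ∀ {u v : List ℕ} b → u ++ b ↭ v ++ b → u ↭ v
dropSuffix {u} {v} b p = dropPrefix b (↭-trans (++-comm b u) (↭-trans p (++-comm v b)))

extract₂ : ∀ {x y} {Q : List ℕ} → x ≢ y → x ∈ Q → y ∈ Q → ∃ λ Q′ → Q ↭ x ∷ y ∷ Q′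
extract₂ {x} {y} x≢y x∈ y∈
  with u , v , refl ← ∈-∃++ x∈
  with ∈-resp-↭ (shift x u v) y∈
... | here y≡x = contradiction (sym y≡x) x≢y
... | there y∈uv with u′ , v′ , eq ← ∈-∃++ y∈uv
  = u′ ++ v′ , ↭-trans (shift x u v) (↭-prep x (↭-trans (↭-reflexive eq) (shift y u′ v′)))

-- A list that is strictly ordered is determined by its set of entries.
AllPairs-unique : ∀ {R : Rel ℕ 0ℓ} → Asymmetric R → ∀ {u v} →
                  AllPairs R u → AllPairs R v → u ⊆ v → v ⊆ u → u ≡ v
AllPairs-unique asym []      []      _   _   = refl
AllPairs-unique asym []      (_ ∷ _) _   v⊆u with () ← v⊆u (here refl)
AllPairs-unique asym (_ ∷ _) []      u⊆v _   with () ← u⊆v (here refl)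
AllPairs-unique {R} asym {x ∷ u} {y ∷ v} (x≺u ∷ su) (y≺v ∷ sv) u⊆v v⊆u =
  go (u⊆v (here refl)) (v⊆u (here refl))
  where
  tail⊆ : ∀ {h a b} → All (h ≢_) a → a ⊆ h ∷ b → a ⊆ b
  tail⊆ x∉ a⊆ w∈ with a⊆ w∈
  ... | here refl = contradiction refl (All.lookup x∉ w∈)
  ... | there w∈b = w∈b
  head∉ : ∀ {h t} → All (R h) t → All (h ≢_) t
  head∉ = All.map λ { h≺ refl → asym h≺ h≺ }
  go : x ∈ y ∷ v → y ∈ x ∷ u → x ∷ u ≡ y ∷ v
  go (there x∈v) (there y∈u) = contradiction (All.lookup x≺u y∈u) (asym (All.lookup y≺v x∈v))
  go (there x∈v) (here refl) = contradiction (All.lookup y≺v x∈v) (asym (All.lookup y≺v x∈v))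
  go (here refl) _           = cong (x ∷_) (AllPairs-unique asym su sv
    (tail⊆ (head∉ x≺u) (u⊆v ∘ there)) (tail⊆ (head∉ y≺v) (v⊆u ∘ there)))

<-unique : ∀ {u v} → AllPairs _<_ u → AllPairs _<_ v → u ⊆ v → v ⊆ u → u ≡ v
<-unique = AllPairs-unique {_} <-asym

>-unique : ∀ {u v} → AllPairs _>_ u → AllPairs _>_ v → u ⊆ v → v ⊆ u → u ≡ v
>-unique = AllPairs-unique {_} <-asym

------------------------------------------------------------------------
-- Letters after a smaller letter permute freely

-- A small letter x standing after an increasing block of larger letters: rotations
-- carry the last letter e of the block to the front, leaving x second. The block
-- can be restored behind any letter f below all of it, because swaps with f and
-- then with the successive letters of the block carry e back to the end.
cycle : ∀ {x} h t → AllPairs _<_ (h ∷ t) → x < h → ∃₂ λ e i → e ∈ h ∷ t ×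
        (∀ R → h ∷ t ++ x ∷ R ~ e ∷ x ∷ i ++ R) ×
        (∀ R {f} → f < h → f ∷ e ∷ i ++ R ~ f ∷ h ∷ t ++ R)
cycle h []      _               _   = h , [] , here refl , (λ _ → ε) , (λ _ _ → ε)
cycle {x} h (k ∷ t) (h<kt@(h<k ∷ _) ∷ s) x<h
  with e , i , e∈ , front , back ← cycle k t s (<-trans x<h h<k)
  = e , h ∷ i , there e∈
  , (λ R → cons~ h (front R) ◅◅ rotate~ x<h h<e)
  , (λ R f<h → ~-sym (swap~ f<h h<e) ◅◅ cons~ _ (back R h<k))
  where h<e = All.lookup h<kt e∈

-- With a letter l smaller than everything in sight, a small letter x moves to the
-- left across an increasing block: cycle the block, swap x past e behind l, and
-- restore the block behind x.
slide : ∀ {l x h t} R → AllPairs _<_ (h ∷ t) → l < x → x < h →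
        l ∷ h ∷ t ++ x ∷ R ~ l ∷ x ∷ h ∷ t ++ R
slide {l} {x} {h} {t} R s@(h<t ∷ _) l<x x<h
  with e , i , e∈ , front , back ← cycle h t s x<h = begin
  l ∷ h ∷ t ++ x ∷ R  ≈⟨ cons~ l (front R) ⟩
  l ∷ e ∷ x ∷ i ++ R  ≈⟨ swap~ l<x x<e ⟨
  l ∷ x ∷ e ∷ i ++ R  ≈⟨ cons~ l (back R x<h) ⟩
  l ∷ x ∷ h ∷ t ++ R  ∎
  where
  open ~-Reasoning
  x<e = All.lookup (x<h ∷ All.map (<-trans x<h) h<t) e∈

-- One step of insertion sort, the sorted list standing directly behind a smaller
-- letter l. The recursion replaces l by the head of the list.
insert : ∀ {l x} s → AllPairs _<_ s → All (l <_) s → l < x → x ∉ s →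
         ∃ λ s′ → AllPairs _<_ s′ × s′ ↭ x ∷ s × (∀ R → l ∷ s ++ x ∷ R ~ l ∷ s′ ++ R)
insert {x = x} [] _ _ _ _ = x ∷ [] , [] ∷ [] , ↭-refl , λ _ → ε
insert {l} {x} (h ∷ t) s@(h<t ∷ t↗) (l<h ∷ _) l<x x∉ with <-cmp x h
... | tri< x<h _ _ = x ∷ h ∷ t , (x<h ∷ All.map (<-trans x<h) h<t) ∷ s , ↭-refl , λ R → slide R s l<x x<h
... | tri≈ _ refl _ = contradiction (here refl) x∉
... | tri> _ _ h<x with t′ , t′↗ , p , r ← insert t t↗ h<t h<x (x∉ ∘ there)
  = h ∷ t′ , All-resp-↭ (↭-sym p) (h<x ∷ h<t) ∷ t′↗
  , ↭-trans (↭-prep h p) (↭-swap h x ↭-refl) , λ R → cons~ l (r R)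

sortFrom : ∀ {l} s R → AllPairs _<_ s → All (l <_) s → All (l <_) R → Unique (s ++ R) →
           ∃ λ s′ → AllPairs _<_ s′ × s′ ↭ s ++ R × l ∷ s ++ R ~ l ∷ s′
sortFrom s [] s↗ _ _ _ rewrite ++-identityʳ s = s , s↗ , ↭-refl , ε
sortFrom s (x ∷ R) s↗ l<s (l<x ∷ l<R) uniq
  with s₁ , s₁↗ , p , r ← insert s s↗ l<s l<x (Unique-++∷⇒∉ˡ s uniq)
  with q ← ↭-trans (++⁺ʳ R p) (↭-sym (shift x s R))
  with s₂ , s₂↗ , p₂ , r₂ ← sortFrom s₁ R s₁↗ (All-resp-↭ (↭-sym p) (l<x ∷ l<s)) l<R
                              (Unique-resp-↭ (↭-sym q) uniq)
  = s₂ , s₂↗ , ↭-trans p₂ q , r R ◅◅ r₂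

-- Both words are equivalent to l followed by the sorted list.
permute : ∀ {l Q Q′} → All (l <_) Q → Unique Q → Q ↭ Q′ → l ∷ Q ~ l ∷ Q′
permute {l} {Q} {Q′} l<Q uniq p
  with s , s↗ , q , r ← sortFrom [] Q [] [] l<Q uniq
  with s′ , s′↗ , q′ , r′ ← sortFrom [] Q′ [] [] (All-resp-↭ p l<Q) (Unique-resp-↭ p uniq)
  with s↭s′ ← ↭-trans q (↭-trans p (↭-sym q′))
  with refl ← <-unique s↗ s′↗ (∈-resp-↭ s↭s′) (∈-resp-↭ (↭-sym s↭s′))
  = r ◅◅ ~-sym r′

------------------------------------------------------------------------
-- Making the letters before the minimum decreasing

-- An ascent y z at the front of an otherwise decreasing prefix is pushed to the
-- right by rotations until it meets o, and there its smaller letter jumps over o.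
-- The prefix loses one letter.
sink : ∀ {o} y z t → AllPairs _>_ (y ∷ t) → y < z → All (o <_) (y ∷ t) →
       ∃₂ λ t′ e → AllPairs _>_ t′ × t′ ⊆ y ∷ t × length t′ ≡ length t ×
       (∀ Q → y ∷ z ∷ t ++ o ∷ Q ~ z ∷ t′ ++ o ∷ e ∷ Q)
sink y z [] _ y<z (o<y ∷ _) = [] , y , [] , (λ ()) , refl , λ _ → rotate~ o<y y<z
sink {o} y z (h ∷ t) (y>ht@(h<y ∷ _) ∷ s) y<z (_ ∷ o<ht)
  with t′ , e , t′↘ , t′⊆ , len , r ← sink h y t s h<y o<ht
  = y ∷ t′ , e , All.anti-mono t′⊆ y>ht ∷ t′↘
  , (λ { (here refl) → here refl ; (there w∈) → there (t′⊆ w∈) })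
  , cong suc len , λ Q → rotate~ h<y y<z ◅◅ cons~ z (r Q)

-- Adding a letter p in front of a decreasing prefix. If p is smaller than the two
-- leading letters d and c, a swap and a sink shorten the prefix and the argument
-- is repeated; k is the length, on which the recursion runs.
straighten : ∀ {o} k p D → length D ≡ k → AllPairs _>_ D → All (o <_) (p ∷ D) → p ∉ D → ∀ Q →
             ∃₂ λ D′ Q′ → AllPairs _>_ D′ × All (o <_) D′ × p ∷ D ++ o ∷ Q ~ D′ ++ o ∷ Q′
straighten k p [] _ _ o<p _ Q = p ∷ [] , Q , [] ∷ [] , o<p , ε
straighten k p (d ∷ []) _ D↘ o<pD@(o<p ∷ o<d ∷ []) p∉ Q with <-cmp p d
... | tri< p<d _ _  = d ∷ [] , p ∷ Q , D↘ , o<d ∷ [] , rotate~ o<p p<d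
... | tri≈ _ refl _ = contradiction (here refl) p∉
... | tri> _ _ d<p  = p ∷ d ∷ [] , Q , (d<p ∷ []) ∷ D↘ , o<pD , ε
straighten (suc k) p (d ∷ c ∷ t) len D↘@(d>ct@(c<d ∷ _) ∷ ct↘@(c>t ∷ _)) o<pD@(o<p ∷ o<d ∷ o<ct) p∉ Q
  with <-cmp p d
... | tri≈ _ refl _ = contradiction (here refl) p∉
... | tri> _ _ d<p  = p ∷ d ∷ c ∷ t , Q , (d<p ∷ All.map (λ w<d → <-trans w<d d<p) d>ct) ∷ D↘ , o<pD , ε
... | tri< p<d _ _  with <-cmp p c
...   | tri≈ _ refl _ = contradiction (there (here refl)) p∉
...   | tri> _ _ c<p
  with t′ , e , t′↘ , t′⊆ , _ , r ←
         sink p d (c ∷ t) ((c<p ∷ All.map (λ w<c → <-trans w<c c<p) c>t) ∷ ct↘) p<d (o<p ∷ o<ct)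
  = d ∷ t′ , e ∷ Q , All.anti-mono t′⊆ (p<d ∷ d>ct) ∷ t′↘ , o<d ∷ All.anti-mono t′⊆ (o<p ∷ o<ct) , r Q
...   | tri< p<c _ _
  with t′ , e , t′↘ , t′⊆ , len′ , r ← sink c d t ct↘ c<d o<ct
  with D′ , Q′ , D′↘ , o<D′ , r′ ←
         straighten k p (d ∷ t′) (trans (cong suc len′) (suc-injective len))
           (All.anti-mono t′⊆ d>ct ∷ t′↘) (o<p ∷ o<d ∷ All.anti-mono t′⊆ o<ct)
           (λ { (here refl) → p∉ (here refl) ; (there p∈) → p∉ (there (t′⊆ p∈)) }) (e ∷ Q)
  = D′ , Q′ , D′↘ , o<D′ , ~-sym (swap~ p<c c<d) ◅◅ cons~ p (r Q) ◅◅ r′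

reduce : ∀ {o} P Q → All (o <_) P → Unique (P ++ o ∷ Q) →
         ∃₂ λ D Q′ → AllPairs _>_ D × All (o <_) D × P ++ o ∷ Q ~ D ++ o ∷ Q′
reduce [] Q _ _ = [] , Q , [] , [] , ε
reduce (p ∷ P) Q (o<p ∷ o<P) uniq@(_ ∷ uniq′)
  with D , Q₁ , D↘ , o<D , r ← reduce P Q o<P uniq′
  with D′ , Q₂ , D′↘ , o<D′ , r′ ← straighten (length D) p D refl D↘ (o<p ∷ o<D)
         (Unique.Unique[x∷xs]⇒x∉xs (Unique-resp-↭ (~⇒↭ (cons~ p r)) uniq) ∘ ∈-++⁺ˡ) Q₁
  = D′ , Q₂ , D′↘ , o<D′ , cons~ p r ◅◅ r′

------------------------------------------------------------------------
-- Shortening a decreasing prefix above two spare letters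

-- A letter d of the prefix, preceded by a larger letter e, can be moved behind the
-- minimum o when two letters between o and d follow o.
absorb : ∀ {o x y d e Q} → o < x → x < y → y < d → d < e →
         e ∷ d ∷ o ∷ x ∷ y ∷ Q ~ e ∷ o ∷ y ∷ d ∷ x ∷ Q
absorb {o} {x} {y} {d} {e} {Q} o<x x<y y<d d<e = begin
  e ∷ d ∷ o ∷ x ∷ y ∷ Q  ≈⟨ cons~ e (rotate~ o<x x<d) ⟨
  e ∷ x ∷ d ∷ o ∷ y ∷ Q  ≈⟨ cons~ e (cons~ x (rotate~ o<y y<d)) ⟨
  e ∷ x ∷ y ∷ d ∷ o ∷ Q  ≈⟨ rotate~ x<y y<e ⟨
  y ∷ e ∷ x ∷ d ∷ o ∷ Q  ≈⟨ cons~ y (cons~ e (rotate~ o<x x<d)) ⟩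
  y ∷ e ∷ d ∷ o ∷ x ∷ Q  ≈⟨ swap~ y<d d<e ⟨
  y ∷ d ∷ e ∷ o ∷ x ∷ Q  ≈⟨ cons~ y (rotate~ o<d d<e) ⟩
  y ∷ e ∷ o ∷ d ∷ x ∷ Q  ≈⟨ rotate~ o<y y<e ⟩
  e ∷ o ∷ y ∷ d ∷ x ∷ Q  ∎
  where
  open ~-Reasoning
  x<d = <-trans x<y y<d
  y<e = <-trans y<d d<e
  o<y = <-trans o<x x<y
  o<d = <-trans o<y y<d

-- A decreasing prefix whose letters exceed two letters x and y that stand behind
-- the minimum is equivalent to its first letter alone.
collapse : ∀ {o x y} e t Q → o < x → x < y → AllPairs _>_ (e ∷ t) → All (y <_) (e ∷ t) →
           All (o <_) Q → Unique (t ++ Q) → x ∈ Q → y ∈ Q →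
           ∃ λ Q′ → e ∷ t ++ o ∷ Q ~ e ∷ o ∷ Q′
collapse e [] Q _ _ _ _ _ _ _ _ = Q , ε
collapse {o} {x} {y} e (d ∷ t) Q o<x x<y ((d<e ∷ _) ∷ dt↘) (y<e ∷ y<dt@(y<d ∷ y<t)) o<Q uniq@(_ ∷ uniq′) x∈ y∈
  with Q₁ , r ← collapse d t Q o<x x<y dt↘ y<dt o<Q uniq′ x∈ y∈
  with p ← drop-mid t [] (drop-∷ (~⇒↭ r))
  with Q₂ , q ← extract₂ (<⇒≢ x<y) (∈-resp-↭ p (∈-++⁺ʳ t x∈)) (∈-resp-↭ p (∈-++⁺ʳ t y∈))
  = _ , cons~ e r
       ◅◅ cons~ e (cons~ d (permute (All-resp-↭ p (All.++⁺ (All.map (<-trans (<-trans o<x x<y)) y<t) o<Q))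
                                    (Unique-resp-↭ p uniq′) q))
       ◅◅ absorb o<x x<y y<d d<e

------------------------------------------------------------------------
-- Counting non-inversions

-- The indicator of x < y, as a number.
χ : ℕ → ℕ → ℕ
χ x y = if does (x <? y) then 1 else 0

χ-yes : ∀ {x y} → x < y → χ x y ≡ 1
χ-yes {x} {y} x<y = cong (if_then 1 else 0) (dec-true (x <? y) x<y)

χ-no : ∀ {x y} → y < x → χ x y ≡ 0
χ-no {x} {y} y<x = cong (if_then 1 else 0) (dec-false (x <? y) (<-asym y<x))

-- The number of entries of u that are greater than x.
larger : ℕ → List ℕ → ℕ
larger x u = sum (map (χ x) u)

larger-++ : ∀ x u v → larger x (u ++ v) ≡ larger x u + larger x v
larger-++ x u v = trans (cong sum (map-++ (χ x) u v)) (sum-++ (map (χ x) u) (map (χ x) v))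

larger-↭ : ∀ x {u v} → u ↭ v → larger x u ≡ larger x v
larger-↭ x p = sum-↭ (map⁺ (χ x) p)

-- The number of non-inversions: pairs of entries in increasing order.
noninv : List ℕ → ℕ
noninv []      = 0
noninv (x ∷ u) = larger x u + noninv u

noninv-++-cong : ∀ a {u v} → u ↭ v → noninv u ≡ noninv v → noninv (a ++ u) ≡ noninv (a ++ v)
noninv-++-cong []      p eq = eq
noninv-++-cong (h ∷ a) p eq = cong₂ _+_ (larger-↭ h (++⁺ˡ a p)) (noninv-++-cong a p eq)

noninv-++ʳ : ∀ a v → noninv v ≤ noninv (a ++ v)
noninv-++ʳ []      v = ≤-refl
noninv-++ʳ (h ∷ a) v = ≤-trans (noninv-++ʳ a v) (m≤n+m _ (larger h (a ++ v)))

larger-++ʳ : ∀ x a v → larger x v ≤ larger x (a ++ v)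
larger-++ʳ x a v = ≤-trans (m≤n+m _ (larger x a)) (≤-reflexive (sym (larger-++ x a v)))

-- A letter p in front of v contributes the entries of v greater than p.
noninv-∈ : ∀ {p} a v → p ∈ a → larger p v + noninv v ≤ noninv (a ++ v)
noninv-∈ (h ∷ a) v (here refl) = +-mono-≤ (larger-++ʳ h a v) (noninv-++ʳ a v)
noninv-∈ (h ∷ a) v (there p∈)  = ≤-trans (noninv-∈ a v p∈) (m≤n+m _ (larger h (a ++ v)))

noninv-∈₂ : ∀ {p q} a v → p ≢ q → p ∈ a → q ∈ a →
            larger p v + (larger q v + noninv v) ≤ noninv (a ++ v)
noninv-∈₂ (h ∷ a) v p≢q (here refl) (here refl) = contradiction refl p≢q
noninv-∈₂ (h ∷ a) v p≢q (here refl) (there q∈)  = +-mono-≤ (larger-++ʳ h a v) (noninv-∈ a v q∈)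
noninv-∈₂ {p} {q} (h ∷ a) v p≢q (there p∈) (here refl) = begin
  larger p v + (larger h v + noninv v)  ≡⟨ exchange (larger p v) (larger h v) (noninv v) ⟩
  larger h v + (larger p v + noninv v)  ≤⟨ +-mono-≤ (larger-++ʳ h a v) (noninv-∈ a v p∈) ⟩
  noninv (h ∷ a ++ v)                   ∎
  where
  open ≤-Reasoning
  exchange : ∀ i j k → i + (j + k) ≡ j + (i + k)
  exchange = solve-∀
noninv-∈₂ (h ∷ a) v p≢q (there p∈) (there q∈)  =
  ≤-trans (noninv-∈₂ a v p≢q p∈ q∈) (m≤n+m _ (larger h (a ++ v)))

noninv-rotate : ∀ {x y z} c → x < y → y < z → noninv (y ∷ z ∷ x ∷ c) ≡ noninv (z ∷ x ∷ y ∷ c)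
noninv-rotate {x} {y} {z} c x<y y<z
  rewrite χ-yes y<z | χ-no x<y | χ-no (<-trans x<y y<z) | χ-no y<z | χ-yes x<y
  = arith (larger x c) (larger y c) (larger z c) (noninv c)
  where
  arith : ∀ i j k l → suc j + (k + (i + l)) ≡ k + (suc i + (j + l))
  arith = solve-∀

------------------------------------------------------------------------
-- The invariant

maximum : List ℕ → ℕ
maximum = foldr _⊔_ 0

maximum-↭ : ∀ {u v} → u ↭ v → maximum u ≡ maximum v
maximum-↭ p = Permutationₛ.foldr-commMonoid (≡.setoid ℕ) ⊔-0-isCommutativeMonoid (↭⇒↭ₛ p)

maximum-++-cong : ∀ a {u v} → maximum u ≡ maximum v → maximum (a ++ u) ≡ maximum (a ++ v)
maximum-++-cong []      eq = eq
maximum-++-cong (h ∷ a) eq = cong (h ⊔_) (maximum-++-cong a eq)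

-- Whether the letter k occurs in P, as a Boolean.
has : ℕ → List ℕ → Bool
has k P = does (k ∈? P)

has-cong : ∀ {k P P′} → (k ∈ P → k ∈ P′) → (k ∈ P′ → k ∈ P) → has k P ≡ has k P′
has-cong {k} {P} {P′} f g = does-⇔ (mk⇔ f g) (k ∈? P) (k ∈? P′)

-- Which of the letters 4, …, 3 + m occur in P, the largest letter first.
bits : ∀ m → List ℕ → Vec Bool m
bits zero    P = []
bits (suc m) P = has (4 + m) P ∷ bits m P

bits-cong : ∀ m {P P′} → (∀ {k} → 4 ≤ k → has k P ≡ has k P′) → bits m P ≡ bits m P′
bits-cong zero    eq = refl
bits-cong (suc m) eq = cong₂ _∷_ (eq (m≤m+n 4 m)) (bits-cong m eq)

-- The number of non-inversions formed by 1 and 2, given whether 2 precedes 1.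
absent : Bool → ℕ
absent b = if b then 0 else 1

-- For a word with P in front of its letter 1, the number of non-inversions in the
-- subword formed by P together with the letters 1 and 2.
defect : List ℕ → ℕ
defect P = noninv P + absent (has 2 P)

-- The values of the invariant on words with 3 + m letters. On the left, the
-- element of Fin 3 tells which of 2 and 3 belong to a decreasing prefix, namely
-- both, only 2 or only 3, and the bits list its larger letters. On the right,
-- zero stands for the empty prefix and suc i for the prefix with greatest letter
-- 4 + i.
Key : ℕ → Set
Key m = (Fin 3 × Vec Bool m) ⊎ Fin (suc m)

classify : ∀ {m} → ℕ → Bool → Vec Bool m → Fin (suc m) → Key m
classify 0             true  b k = inj₁ (0F , b)
classify 0             false b k = inj₁ (1F , b)
classify 1             true  b k = inj₁ (2F , b)
classify 1             false b k = inj₂ k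
classify (suc (suc _)) _     b k = inj₂ k

-- The invariant in terms of the word P in front of the letter 1. The letters being
-- at most 3 + m, the difference maximum P ∸ 3 is at most m, so that the remainder
-- modulo suc m changes nothing; it only serves to make keyOf total.
keyOf : ∀ m → List ℕ → Key m
keyOf m P = classify (defect P) (has 3 P) (bits m P) ((maximum P ∸ 3) mod suc m)

keyOf-cong : ∀ m {P P′} → defect P ≡ defect P′ → (∀ {k} → 3 ≤ k → has k P ≡ has k P′) →
             maximum P ≡ maximum P′ → keyOf m P ≡ keyOf m P′
keyOf-cong m {P} {P′} eq h≡ m≡
  rewrite eq | h≡ ≤-refl | bits-cong m {P} {P′} (λ 4≤k → h≡ (≤-trans (n≤1+n 3) 4≤k)) | m≡ = refl

-- The words P on which keyOf takes a value in the right summand.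
Late : List ℕ → Set
Late P = 2 ≤ defect P ⊎ (1 ≤ defect P × 3 ∉ P)

keyOf-late : ∀ m {P} → Late P → keyOf m P ≡ inj₂ ((maximum P ∸ 3) mod suc m)
keyOf-late m {P} late =
  go (defect P) (has 3 P) ([ inj₁ , (λ (d , 3∉) → inj₂ (d , dec-false (3 ∈? P) 3∉)) ]′ late)
  where
  go : ∀ d h {b : Vec Bool m} {k} → 2 ≤ d ⊎ (1 ≤ d × h ≡ false) → classify d h b k ≡ inj₂ k
  go 0 _ (inj₁ ())
  go 0 _ (inj₂ ())
  go 1 _ (inj₁ (s≤s ()))
  go 1 _ (inj₂ (_ , refl)) = refl
  go (suc (suc _)) _ _ = refl

keyOf-late-cong : ∀ m {P P′} → Late P → Late P′ → maximum P ≡ maximum P′ → keyOf m P ≡ keyOf m P′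
keyOf-late-cong m l l′ eq =
  trans (keyOf-late m l) (trans (cong (λ k → inj₂ ((k ∸ 3) mod suc m)) eq) (sym (keyOf-late m l′)))

noninv≤defect : ∀ P → noninv P ≤ defect P
noninv≤defect P = m≤m+n (noninv P) _

2∉⇒defect : ∀ P → 2 ∉ P → defect P ≡ suc (noninv P)
2∉⇒defect P 2∉ rewrite dec-false (2 ∈? P) 2∉ = +-comm (noninv P) 1

2∈⇒defect : ∀ P → 2 ∈ P → defect P ≡ noninv P
2∈⇒defect P 2∈ rewrite dec-true (2 ∈? P) 2∈ = +-identityʳ (noninv P)

------------------------------------------------------------------------
-- Invariance under the moves

-- A swap inside P changes the number of non-inversions by one, but both words have
-- at least two of them, so only the maximum matters.
keyOf-swap : ∀ m a {x y z} c → x < y → y < z →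
             keyOf m (a ++ x ∷ y ∷ z ∷ c) ≡ keyOf m (a ++ x ∷ z ∷ y ∷ c)
keyOf-swap m a {x} {y} {z} c x<y y<z =
  keyOf-late-cong m (late (χ-yes x<y) (χ-yes x<z)) (late (χ-yes x<z) (χ-yes x<y))
    (maximum-↭ (++⁺ˡ a (↭-prep x (↭-swap y z ↭-refl))))
  where
  x<z = <-trans x<y y<z
  late : ∀ {s t} → χ x s ≡ 1 → χ x t ≡ 1 → Late (a ++ x ∷ s ∷ t ∷ c)
  late {s} {t} es et = inj₁ (≤-trans (≤-trans two (noninv-++ʳ a _)) (noninv≤defect (a ++ x ∷ s ∷ t ∷ c)))
    where
    two : 2 ≤ noninv (x ∷ s ∷ t ∷ c)
    two rewrite es | et = s≤s (s≤s z≤n)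

-- A rotation inside P preserves the number of non-inversions.
keyOf-rotate : ∀ m a {x y z} c → x < y → y < z →
               keyOf m (a ++ y ∷ z ∷ x ∷ c) ≡ keyOf m (a ++ z ∷ x ∷ y ∷ c)
keyOf-rotate m a {x} {y} {z} c x<y y<z =
  keyOf-cong m (cong₂ _+_ (noninv-++-cong a q (noninv-rotate c x<y y<z)) (cong absent has≡))
    (λ _ → has≡) (maximum-↭ p)
  where
  q : y ∷ z ∷ x ∷ c ↭ z ∷ x ∷ y ∷ c
  q = ↭-trans (↭-swap y z ↭-refl) (↭-prep z (↭-swap y x ↭-refl))
  p = ++⁺ˡ a q
  has≡ : ∀ {k} → has k (a ++ y ∷ z ∷ x ∷ c) ≡ has k (a ++ z ∷ x ∷ y ∷ c)
  has≡ = has-cong (∈-resp-↭ p) (∈-resp-↭ (↭-sym p))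

-- A rotation y z 1 ↦ z 1 y takes y out of P. For y = 2 the lost non-inversion of
-- 2 and z is replaced by that of 1 and 2. For y > 2 the words on both sides are
-- late, and y is not the maximum.
keyOf-drop : ∀ m a {y z} → All (2 ≤_) a → y ∉ a → 2 ≤ y → y < z →
             keyOf m (a ++ y ∷ z ∷ []) ≡ keyOf m (a ++ z ∷ [])
keyOf-drop m a {y} {z} 2≤a y∉a 2≤y y<z with y ≟ 2
... | yes refl = keyOf-cong m defect≡ has≡ max≡
  where
  2<a : All (2 <_) a
  2<a = All.tabulate λ {w} w∈ → ≤∧≢⇒< (All.lookup 2≤a w∈) λ { refl → y∉a w∈ }
  noninv≡ : ∀ {b} → All (2 <_) b → noninv (b ++ 2 ∷ z ∷ []) ≡ suc (noninv (b ++ z ∷ []))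
  noninv≡ [] rewrite χ-yes y<z = refl
  noninv≡ {h ∷ b} (2<h ∷ 2<b)
    rewrite larger-++ h b (2 ∷ z ∷ []) | larger-++ h b (z ∷ []) | χ-no 2<h | noninv≡ 2<b
    = +-suc _ _
  2∉ : 2 ∉ a ++ z ∷ []
  2∉ 2∈ with ∈-++⁻ a 2∈
  ... | inj₁ 2∈a        = y∉a 2∈a
  ... | inj₂ (here refl) = <-irrefl refl y<z
  defect≡ : defect (a ++ 2 ∷ z ∷ []) ≡ defect (a ++ z ∷ [])
  defect≡ = trans (2∈⇒defect (a ++ 2 ∷ z ∷ []) (∈-++⁺ʳ a (here refl)))
           (trans (noninv≡ 2<a) (sym (2∉⇒defect (a ++ z ∷ []) 2∉)))
  has≡ : ∀ {k} → 3 ≤ k → has k (a ++ 2 ∷ z ∷ []) ≡ has k (a ++ z ∷ [])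
  has≡ {k} 3≤k = has-cong (λ k∈ → ∈-resp-↭ (↭-sym (shift z a [])) (lose k∈)) λ k∈ →
    ∈-resp-↭ (↭-sym (shift 2 a (z ∷ []))) (there k∈)
    where
    lose : k ∈ a ++ 2 ∷ z ∷ [] → k ∈ z ∷ a ++ []
    lose k∈ with ∈-resp-↭ (shift 2 a (z ∷ [])) k∈
    ... | here refl = contradiction 3≤k (<-irrefl refl)
    ... | there k∈′ = ∈-resp-↭ (shift z a []) k∈′
  max≡ = maximum-++-cong a {2 ∷ z ∷ []} {z ∷ []} (m≤n⇒m⊔n≡n (≤-trans (<⇒≤ y<z) (m≤m⊔n z 0)))
-- On the left, y < z is a non-inversion; a second one is formed by 1 and 2, or else
-- by a letter 2 in front of y. On the right, z exceeds each of 2 and 3 that occurs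
-- in front of it.
... | no y≢2 = keyOf-late-cong m (inj₁ late₁) late₂ max≡
  where
  2<y = ≤∧≢⇒< 2≤y (y≢2 ∘ sym)
  3<z = ≤-<-trans 2<y y<z
  2<z = <-trans 2<y y<z
  P₁ = a ++ y ∷ z ∷ []
  P₂ = a ++ z ∷ []
  max≡ = maximum-++-cong a {y ∷ z ∷ []} {z ∷ []} (m≤n⇒m⊔n≡n (≤-trans (<⇒≤ y<z) (m≤m⊔n z 0)))
  ∉-++ : ∀ {k} v → k ∉ a → All (k <_) v → k ∉ a ++ v
  ∉-++ v k∉ k<v k∈ = [ k∉ , (λ k∈v → <-irrefl refl (All.lookup k<v k∈v)) ]′ (∈-++⁻ a k∈)
  late₁ : 2 ≤ defect P₁
  late₁ with 2 ∈? a
  ... | yes 2∈ = ≤-trans (≤-trans two (noninv-∈ a (y ∷ z ∷ []) 2∈)) (noninv≤defect P₁)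
    where
    two : 2 ≤ larger 2 (y ∷ z ∷ []) + noninv (y ∷ z ∷ [])
    two rewrite χ-yes 2<y | χ-yes 2<z = s≤s (s≤s z≤n)
  ... | no 2∉ rewrite 2∉⇒defect P₁ (∉-++ _ 2∉ (2<y ∷ 2<z ∷ [])) = s≤s (≤-trans one (noninv-++ʳ a _))
    where
    one : 1 ≤ noninv (y ∷ z ∷ [])
    one rewrite χ-yes y<z = s≤s z≤n
  one′ : ∀ {p} → p < z → 1 ≤ larger p (z ∷ []) + 0
  one′ p<z rewrite χ-yes p<z = s≤s z≤n
  late₂ : Late P₂
  late₂ with 2 ∈? a | 3 ∈? a
  ... | yes 2∈ | no 3∉  = inj₂ (≤-trans (≤-trans (one′ 2<z) (noninv-∈ a (z ∷ []) 2∈)) (noninv≤defect P₂)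
                               , ∉-++ _ 3∉ (3<z ∷ []))
  ... | yes 2∈ | yes 3∈ = inj₁ (≤-trans (≤-trans two (noninv-∈₂ a (z ∷ []) (λ ()) 2∈ 3∈)) (noninv≤defect P₂))
    where
    two : 2 ≤ larger 2 (z ∷ []) + (larger 3 (z ∷ []) + 0)
    two rewrite χ-yes 2<z | χ-yes 3<z = s≤s (s≤s z≤n)
  ... | no 2∉ | yes 3∈ rewrite 2∉⇒defect P₂ (∉-++ _ 2∉ (2<z ∷ [])) =
    inj₁ (s≤s (≤-trans (one′ 3<z) (noninv-∈ a (z ∷ []) 3∈)))
  ... | no 2∉ | no 3∉ rewrite 2∉⇒defect P₂ (∉-++ _ 2∉ (2<z ∷ [])) =
    inj₂ (s≤s z≤n , ∉-++ _ 3∉ (3<z ∷ []))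

-- The part of a word in front of its first letter 1.
before : List ℕ → List ℕ
before []      = []
before (x ∷ w) = if does (x ≟ 1) then [] else x ∷ before w

before-≢1 : ∀ {h} w → h ≢ 1 → before (h ∷ w) ≡ h ∷ before w
before-≢1 {h} w h≢1 = cong (if_then [] else h ∷ before w) (dec-false (h ≟ 1) h≢1)

before-∈ : ∀ a u v → 1 ∈ a → before (a ++ u) ≡ before (a ++ v)
before-∈ (h ∷ a) u v 1∈ with h ≟ 1 | 1∈
... | yes refl | _         = refl
... | no h≢1   | here refl = contradiction refl h≢1
... | no h≢1   | there 1∈′ = trans (before-≢1 (a ++ u) h≢1)
  (trans (cong (h ∷_) (before-∈ a u v 1∈′)) (sym (before-≢1 (a ++ v) h≢1)))

before-∉ : ∀ a u → 1 ∉ a → before (a ++ u) ≡ a ++ before u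
before-∉ []      u 1∉ = refl
before-∉ (h ∷ a) u 1∉ = trans (before-≢1 (a ++ u) λ { refl → 1∉ (here refl) })
  (cong (h ∷_) (before-∉ a u (1∉ ∘ there)))

key : ∀ m → List ℕ → Key m
key m w = keyOf m (before w)

-- Words of distinct positive letters.
Valid : List ℕ → Set
Valid u = All (1 ≤_) u × Unique u

key-move : ∀ m a {u v} → 1 ∉ a → Valid (a ++ u) → Move u v → key m (a ++ u) ≡ key m (a ++ v)
key-move m a {u} {v} 1∉ (pos , uniq) move rewrite before-∉ a u 1∉ | before-∉ a v 1∉ =
  go move (All.++⁻ʳ a pos)
  where
  go : Move u v → All (1 ≤_) u → keyOf m (a ++ before u) ≡ keyOf m (a ++ before v)
  -- The letter 1 can only be the smallest letter of the window.
  go (swap {1} b (s≤s (s≤s _)) (s≤s (s≤s _))) _ = refl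
  go (swap {suc (suc _)} b x<y@(s≤s (s≤s _)) y<z@(s≤s (s≤s _))) _ = keyOf-swap m a (before b) x<y y<z
  go (rotate {1} {y} {z} b (s≤s (s≤s _)) y<z@(s≤s (s≤s _))) _ =
    keyOf-drop m a 2≤a (Unique-++∷⇒∉ˡ a uniq) (s≤s (s≤s z≤n)) y<z
    where
    2≤a : All (2 ≤_) a
    2≤a = All.tabulate λ {w} w∈ → ≤∧≢⇒< (All.lookup (All.++⁻ˡ a pos) w∈) λ { refl → 1∉ w∈ }
  go (rotate {suc (suc _)} b x<y@(s≤s (s≤s _)) y<z@(s≤s (s≤s _))) _ = keyOf-rotate m a (before b) x<y y<z
  go (swap {0} _ _ _) (() ∷ _)
  go (rotate {0} _ _ _) (_ ∷ _ ∷ () ∷ _)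

key-step : ∀ m {u v} → Valid u → Step u v → key m u ≡ key m v
key-step m valid (at a {u} {v} move) with 1 ∈? a
... | yes 1∈ = cong (keyOf m) (before-∈ a u v 1∈)
... | no 1∉  = key-move m a 1∉ valid move

Valid-resp-↭ : ∀ {u v} → u ↭ v → Valid u → Valid v
Valid-resp-↭ p (pos , uniq) = All-resp-↭ p pos , Unique-resp-↭ p uniq

key-~ : ∀ m {u v} → Valid u → u ~ v → key m u ≡ key m v
key-~ m valid ε              = refl
key-~ m valid (fwd s ◅ rest) =
  trans (key-step m valid s) (key-~ m (Valid-resp-↭ (~⇒↭ (fwd s ◅ ε)) valid) rest)
key-~ m valid (bwd s ◅ rest) = trans (sym (key-step m valid′ s)) (key-~ m valid′ rest)
  where valid′ = Valid-resp-↭ (~⇒↭ (bwd s ◅ ε)) valid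

------------------------------------------------------------------------
-- The invariant of a decreasing prefix

before-++-1 : ∀ {D} Q → All (1 <_) D → before (D ++ 1 ∷ Q) ≡ D
before-++-1 {D} Q 1<D = trans (before-∉ D (1 ∷ Q) λ 1∈ → <-irrefl refl (All.lookup 1<D 1∈)) (++-identityʳ D)

noninv-decreasing : ∀ {D} → AllPairs _>_ D → noninv D ≡ 0
noninv-decreasing []        = refl
noninv-decreasing (x> ∷ D↘) = cong₂ _+_ (none x>) (noninv-decreasing D↘)
  where
  none : ∀ {x u} → All (_< x) u → larger x u ≡ 0
  none []         = refl
  none (y<x ∷ u<) = cong₂ _+_ (χ-no y<x) (none u<)

keyOf-decreasing : ∀ m {D} → AllPairs _>_ D → keyOf m D ≡
  classify (absent (has 2 D)) (has 3 D) (bits m D) ((maximum D ∸ 3) mod suc m)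
keyOf-decreasing m {D} D↘ =
  cong (λ d → classify (d + absent (has 2 D)) (has 3 D) (bits m D) ((maximum D ∸ 3) mod suc m))
    (noninv-decreasing D↘)

-- The key of a decreasing prefix tells which of 2 and 3 belong to it. If one of
-- them does, the key also determines the bits, and otherwise the last argument.
classify-injective : ∀ {m} {B B′ : Vec Bool m} {k k′} t h t′ h′ →
  classify (absent t) h B k ≡ classify (absent t′) h′ B′ k′ →
  (t ≡ t′ × h ≡ h′ × B ≡ B′) ⊎ ((t ≡ false × h ≡ false) × (t′ ≡ false × h′ ≡ false) × k ≡ k′)
classify-injective true  true  true  true  refl = inj₁ (refl , refl , refl)
classify-injective true  false true  false refl = inj₁ (refl , refl , refl)
classify-injective false true  false true  refl = inj₁ (refl , refl , refl)
classify-injective false false false false refl = inj₂ ((refl , refl) , (refl , refl) , refl)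
classify-injective true  true  true  false ()
classify-injective true  true  false true  ()
classify-injective true  true  false false ()
classify-injective true  false true  true  ()
classify-injective true  false false true  ()
classify-injective true  false false false ()
classify-injective false true  true  true  ()
classify-injective false true  true  false ()
classify-injective false true  false false ()
classify-injective false false true  true  ()
classify-injective false false true  false ()
classify-injective false false false true  ()

has-true⇒∈ : ∀ {k P} → has k P ≡ true → k ∈ P
has-true⇒∈ {k} {P} eq = witness (k ∈? P) eq
  where
  witness : ∀ {A : Set} (a? : Dec A) → does a? ≡ true → A
  witness (yes a) _ = a

∈⇒has-true : ∀ {k P} → k ∈ P → has k P ≡ true
∈⇒has-true {k} {P} = dec-true (k ∈? P)

has-false⇒∉ : ∀ {k P} → has k P ≡ false → k ∉ P
has-false⇒∉ eq k∈ with () ← trans (sym (∈⇒has-true k∈)) eq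

bits≡⇒has≡ : ∀ m {P P′ k} → bits m P ≡ bits m P′ → 4 ≤ k → k ≤ 3 + m → has k P ≡ has k P′
bits≡⇒has≡ zero    eq 4≤k k≤3 = contradiction (≤-trans 4≤k k≤3) (<-irrefl refl)
bits≡⇒has≡ (suc m) {k = k} eq 4≤k k≤ with k ≟ 4 + m | ∷-injective eq
... | yes refl | eq₀ , _ = eq₀
... | no k≢    | _ , eq′ = bits≡⇒has≡ m eq′ 4≤k (≤-pred (≤∧≢⇒< k≤ k≢))

-- The decreasing prefixes that collapse cannot shorten, as a condition added to
-- being decreasing.
data Normal : List ℕ → Set where
  has2   : ∀ {D} → 2 ∈ D → Normal D
  has3   : ∀ {D} → 3 ∈ D → Normal D
  empty  : Normal []
  single : ∀ {e} → 4 ≤ e → Normal (e ∷ [])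

mod-injective : ∀ {i j} m → i ≤ m → j ≤ m → i mod suc m ≡ j mod suc m → i ≡ j
mod-injective {i} {j} m i≤m j≤m eq =
  trans (sym (toℕ-mod i≤m)) (trans (cong toℕ eq) (toℕ-mod j≤m))
  where
  toℕ-mod : ∀ {i} → i ≤ m → toℕ (i mod suc m) ≡ i
  toℕ-mod {i} i≤m = trans (toℕ-fromℕ< (m%n<n i (suc m))) (m<n⇒m%n≡m (s≤s i≤m))

normal-injective : ∀ m {D D′} → AllPairs _>_ D → AllPairs _>_ D′ →
  All (1 <_) D → All (1 <_) D′ → All (_≤ 3 + m) D → All (_≤ 3 + m) D′ →
  Normal D → Normal D′ → keyOf m D ≡ keyOf m D′ → D ≡ D′
normal-injective m {D} {D′} D↘ D′↘ 1<D 1<D′ D≤ D′≤ nf nf′ eq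
  with classify-injective (has 2 D) (has 3 D) (has 2 D′) (has 3 D′)
         (trans (sym (keyOf-decreasing m D↘)) (trans eq (keyOf-decreasing m D′↘)))
... | inj₁ (eq₂ , eq₃ , eqᵇ) =
  >-unique D↘ D′↘ (λ w∈ → transfer has≡ w∈ (All.lookup 1<D w∈) (All.lookup D≤ w∈))
                   (λ w∈ → transfer (λ a b → sym (has≡ a b)) w∈ (All.lookup 1<D′ w∈) (All.lookup D′≤ w∈))
  where
  has≡ : ∀ {k} → 2 ≤ k → k ≤ 3 + m → has k D ≡ has k D′
  has≡ {1} (s≤s ()) _
  has≡ {2} _ _ = eq₂
  has≡ {3} _ _ = eq₃
  has≡ {suc (suc (suc (suc _)))} _ k≤ = bits≡⇒has≡ m eqᵇ (s≤s (s≤s (s≤s (s≤s z≤n)))) k≤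
  transfer : ∀ {E E′ k} → (2 ≤ k → k ≤ 3 + m → has k E ≡ has k E′) → k ∈ E → 2 ≤ k → k ≤ 3 + m → k ∈ E′
  transfer h≡ k∈ 2≤k k≤ = has-true⇒∈ (trans (sym (h≡ 2≤k k≤)) (∈⇒has-true k∈))
... | inj₂ ((no2 , no3) , (no2′ , no3′) , eqᵐ) = go nf nf′ D≤ D′≤ eqᵐ
  where
  go : Normal D → Normal D′ → All (_≤ 3 + m) D → All (_≤ 3 + m) D′ →
       (maximum D ∸ 3) mod suc m ≡ (maximum D′ ∸ 3) mod suc m → D ≡ D′
  go (has2 2∈) _ _ _ _ = contradiction 2∈ (has-false⇒∉ no2)
  go (has3 3∈) _ _ _ _ = contradiction 3∈ (has-false⇒∉ no3)
  go _ (has2 2∈) _ _ _ = contradiction 2∈ (has-false⇒∉ no2′)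
  go _ (has3 3∈) _ _ _ = contradiction 3∈ (has-false⇒∉ no3′)
  go empty empty _ _ _ = refl
  go empty (single (s≤s (s≤s (s≤s (s≤s _))))) _ (s≤s (s≤s (s≤s e≤m)) ∷ []) eq
    with () ← mod-injective m z≤n e≤m eq
  go (single (s≤s (s≤s (s≤s (s≤s _))))) empty (s≤s (s≤s (s≤s e≤m)) ∷ []) _ eq
    with () ← mod-injective m e≤m z≤n eq
  go (single (s≤s (s≤s (s≤s (s≤s _))))) (single (s≤s (s≤s (s≤s (s≤s _)))))
     (s≤s (s≤s (s≤s e≤m)) ∷ []) (s≤s (s≤s (s≤s e′≤m)) ∷ []) eq
    with refl ← mod-injective m e≤m e′≤m eq = refl

------------------------------------------------------------------------
-- Words with letters 1, …, n

-- IsPermutation for words given as lists.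
Perm : ℕ → List ℕ → Set
Perm n w = w ↭ map suc (upTo n)

Perm-length : ∀ {n w} → Perm n w → length w ≡ n
Perm-length {n} p = trans (↭-length p) (trans (length-map suc (upTo n)) (length-upTo n))

Perm⇒≤ : ∀ {n w} → Perm n w → All (_≤ n) w
Perm⇒≤ p = All-resp-↭ (↭-sym p) (All.map⁺ (All.tabulate ∈-upTo⁻))

Perm⇒Valid : ∀ {n w} → Perm n w → Valid w
Perm⇒Valid {n} p = Valid-resp-↭ (↭-sym p)
  ( All.map⁺ (All.tabulate λ _ → s≤s z≤n) , Unique.map⁺ suc-injective (Unique.upTo⁺ n))

Perm⇒∈ : ∀ {n w k} → Perm n w → k < n → suc k ∈ w
Perm⇒∈ p k<n = ∈-resp-↭ (↭-sym p) (∈-map⁺ suc (∈-upTo⁺ k<n))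

∉∧∈⇒∈ʳ : ∀ {k} D {Q} → k ∈ D ++ 1 ∷ Q → k ∉ D → k ≢ 1 → k ∈ Q
∉∧∈⇒∈ʳ D k∈ k∉D k≢1 with ∈-++⁻ D k∈
... | inj₁ k∈D        = contradiction k∈D k∉D
... | inj₂ (here k≡1) = contradiction k≡1 k≢1
... | inj₂ (there k∈Q) = k∈Q

1<-++ : ∀ u v → Valid (u ++ 1 ∷ v) → All (1 <_) (u ++ v)
1<-++ u v valid with pos , uniq ← Valid-resp-↭ (shift 1 u v) valid
  with _ ∷ pos′ ← pos | 1≢ ∷ _ ← uniq = All.zipWith (λ (1≤ , 1≢) → ≤∧≢⇒< 1≤ 1≢) (pos′ , 1≢)

-- A decreasing normal prefix, then 1, then letters in any order.
record NormalForm (w : List ℕ) : Set where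
  field
    D Q        : List ℕ
    decreasing : AllPairs _>_ D
    1<D        : All (1 <_) D
    normal     : Normal D
    w~         : w ~ D ++ 1 ∷ Q

normalise : ∀ {m w} → Perm (3 + m) w → NormalForm w
normalise {m} {w} perm
  with P , R , refl ← ∈-∃++ (Perm⇒∈ perm (s≤s z≤n))
  with valid ← Perm⇒Valid perm
  with D , Q , D↘ , 1<D , r ← reduce P R (All.++⁻ˡ P (1<-++ P R valid)) (proj₂ valid)
  = go D D↘ 1<D r (2 ∈? D) (3 ∈? D)
  where
  go : ∀ D {Q} → AllPairs _>_ D → All (1 <_) D → P ++ 1 ∷ R ~ D ++ 1 ∷ Q →
       Dec (2 ∈ D) → Dec (3 ∈ D) → NormalForm (P ++ 1 ∷ R)
  go D D↘ 1<D r (yes 2∈) _        = record { decreasing = D↘ ; 1<D = 1<D ; normal = has2 2∈ ; w~ = r }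
  go D D↘ 1<D r (no _)   (yes 3∈) = record { decreasing = D↘ ; 1<D = 1<D ; normal = has3 3∈ ; w~ = r }
  go [] D↘ 1<D r (no _)  (no _)   = record { decreasing = D↘ ; 1<D = 1<D ; normal = empty ; w~ = r }
  go (e ∷ t) {Q} D↘ 1<D@(1<e ∷ _) r (no 2∉)  (no 3∉) = finish
    (collapse e t Q (s≤s (s≤s z≤n)) (s≤s (s≤s (s≤s z≤n))) D↘ 3<D
      (All.++⁻ʳ (e ∷ t) 1<DQ) (proj₂ validtQ)
      (∉∧∈⇒∈ʳ (e ∷ t) (∈D 2≤) 2∉ λ ()) (∉∧∈⇒∈ʳ (e ∷ t) (∈D 3≤) 3∉ λ ()))
    where
    p = ~⇒↭ r
    validD = Valid-resp-↭ p (Perm⇒Valid perm)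
    2≤ = s≤s (s≤s z≤n)
    3≤ = s≤s (s≤s (s≤s z≤n))
    ∈D : ∀ {k} → k < 3 + m → suc k ∈ (e ∷ t) ++ 1 ∷ Q
    ∈D k< = ∈-resp-↭ p (Perm⇒∈ perm k<)
    1<DQ = 1<-++ (e ∷ t) Q validD
    3<D : All (3 <_) (e ∷ t)
    3<D = All.tabulate λ {w} w∈ → ≤∧≢⇒< (≤∧≢⇒< (All.lookup 1<D w∈) λ { refl → 2∉ w∈ }) λ { refl → 3∉ w∈ }
    validtQ : Valid (t ++ Q)
    validtQ with _ ∷ _ ∷ pos , _ ∷ _ ∷ uniq ← Valid-resp-↭ (shift 1 (e ∷ t) Q) validD
      = pos , uniq
    finish : (∃ λ Q′ → e ∷ t ++ 1 ∷ Q ~ e ∷ 1 ∷ Q′) → NormalForm (P ++ 1 ∷ R)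
    finish (Q′ , r′) = record
      { Q = Q′ ; decreasing = [] ∷ [] ; 1<D = 1<e ∷ [] ; normal = single (All.head 3<D) ; w~ = r ◅◅ r′ }

-- Normal forms with equal keys have the same prefix, hence the same letters behind
-- the 1, and these permute freely.
key-injective : ∀ {m w w′} → Perm (3 + m) w → Perm (3 + m) w′ → key m w ≡ key m w′ → w ~ w′
key-injective {m} {w} {w′} p p′ eq = connect (normal-injective m
    N.decreasing N′.decreasing N.1<D N′.1<D (bound p N.w~) (bound p′ N′.w~) N.normal N′.normal
    (trans (sym (reduced p nf)) (trans eq (reduced p′ nf′))))
  where
  nf  = normalise p
  nf′ = normalise p′
  module N  = NormalForm nf
  module N′ = NormalForm nf′
  bound : ∀ {u D Q} → Perm (3 + m) u → u ~ D ++ 1 ∷ Q → All (_≤ 3 + m) D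
  bound {D = D} p r = All.++⁻ˡ D (All-resp-↭ (~⇒↭ r) (Perm⇒≤ p))
  reduced : ∀ {u} → Perm (3 + m) u → (nf : NormalForm u) → key m u ≡ keyOf m (NormalForm.D nf)
  reduced p nf = trans (key-~ m (Perm⇒Valid p) w~) (cong (keyOf m) (before-++-1 Q 1<D))
    where open NormalForm nf
  connect : N.D ≡ N′.D → w ~ w′
  connect D≡ = N.w~ ◅◅ subst (λ E → N.D ++ 1 ∷ N.Q ~ E ++ 1 ∷ N′.Q) D≡ (prefix~ N.D (permute 1<Q uniqQ Q↭))
       ◅◅ ~-sym N′.w~
    where
    q : N.D ++ 1 ∷ N.Q ↭ N.D ++ 1 ∷ N′.Q
    q = ↭-trans (↭-sym (~⇒↭ N.w~)) (↭-trans p (↭-trans (↭-sym p′)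
         (↭-trans (~⇒↭ N′.w~) (↭-reflexive (cong (_++ 1 ∷ N′.Q) (sym D≡))))))
    Q↭ = drop-∷ (dropPrefix N.D q)
    valid = Valid-resp-↭ (~⇒↭ N.w~) (Perm⇒Valid p)
    1<Q = All.++⁻ʳ N.D (1<-++ N.D N.Q valid)
    uniqQ : Unique N.Q
    uniqQ with _ ∷ uniq ← Unique-++⁻ʳ N.D (proj₂ valid) = uniq

------------------------------------------------------------------------
-- Every key occurs

1<2 : 1 < 2
1<2 = s≤s (s≤s z≤n)

2<3 : 2 < 3
2<3 = s≤s (s≤s (s≤s z≤n))

-- The letters among 4, …, 3 + m marked by b, in decreasing order.
chosen : ∀ {m} → Vec Bool m → List ℕ
chosen []                  = []
chosen {suc m} (true  ∷ b) = 4 + m ∷ chosen b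
chosen {suc m} (false ∷ b) = chosen b

-- The letters among 4, …, 3 + m not marked by b, in decreasing order.
others : ∀ {m} → Vec Bool m → List ℕ
others []                  = []
others {suc m} (true  ∷ b) = others b
others {suc m} (false ∷ b) = 4 + m ∷ others b

chosen≤ : ∀ {m} (b : Vec Bool m) → All (_≤ 3 + m) (chosen b)
chosen≤ []          = []
chosen≤ (true  ∷ b) = ≤-refl ∷ All.map (λ le → ≤-trans le (n≤1+n _)) (chosen≤ b)
chosen≤ (false ∷ b) = All.map (λ le → ≤-trans le (n≤1+n _)) (chosen≤ b)

3<chosen : ∀ {m} (b : Vec Bool m) → All (3 <_) (chosen b)
3<chosen []                  = []
3<chosen {suc m} (true  ∷ b) = m≤m+n 4 m ∷ 3<chosen b
3<chosen (false ∷ b)         = 3<chosen b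

chosen-decreasing : ∀ {m} (b : Vec Bool m) → AllPairs _>_ (chosen b)
chosen-decreasing []          = []
chosen-decreasing (true  ∷ b) = All.map s≤s (chosen≤ b) ∷ chosen-decreasing b
chosen-decreasing (false ∷ b) = chosen-decreasing b

chosen-others : ∀ {m} (b : Vec Bool m) → chosen b ++ others b ++ 3 ∷ 2 ∷ 1 ∷ [] ↭ map suc (downFrom (3 + m))
chosen-others []                  = ↭-refl
chosen-others {suc m} (true  ∷ b) = ↭-prep (4 + m) (chosen-others b)
chosen-others {suc m} (false ∷ b) =
  ↭-trans (shift (4 + m) (chosen b) _) (↭-prep (4 + m) (chosen-others b))

bits-chosen : ∀ {m} (b : Vec Bool m) {t} → All (_≤ 3) t → bits m (chosen b ++ t) ≡ b
bits-chosen [] t≤ = refl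
bits-chosen {suc m} (true ∷ b) {t} t≤ = cong₂ _∷_ (∈⇒has-true {4 + m} {chosen (true ∷ b) ++ t} (here refl))
  (trans (bits-∷ m ≤-refl) (bits-chosen b t≤))
  where
  bits-∷ : ∀ k {x P} → 3 + k < x → bits k (x ∷ P) ≡ bits k P
  bits-∷ zero    _  = refl
  bits-∷ (suc k) {x} {P} lt = cong₂ _∷_
    (has-cong {4 + k} {x ∷ P} {P}
      (λ { (here refl) → contradiction lt (<-irrefl refl) ; (there k∈) → k∈ }) there)
    (bits-∷ k (<-trans (n<1+n _) lt))
bits-chosen {suc m} (false ∷ b) {t} t≤ = cong₂ _∷_
  (dec-false (4 + m ∈? (chosen b ++ t)) λ 4+m∈ →
    [ (λ ∈c → <-irrefl refl (All.lookup (chosen≤ b) ∈c))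
    , (λ ∈t → <-irrefl refl (≤-trans (m≤m+n 4 m) (All.lookup t≤ ∈t))) ]′ (∈-++⁻ (chosen b) 4+m∈))
  (bits-chosen b t≤)

downFrom-Perm : ∀ {n w} → w ↭ map suc (downFrom n) → Perm n w
downFrom-Perm {n} p = ↭-trans p (map⁺ suc (↭-trans (↭-reflexive (sym (reverse-upTo n))) (↭-reverse (upTo n))))

key-surjective : ∀ m (k : Key m) → ∃ λ w → Perm (3 + m) w × key m w ≡ k
key-surjective m (inj₁ (tag , b)) = realise tag
  where
  prefixKey : List ℕ → Fin (suc m) → Key m
  prefixKey t k = classify (absent (has 2 (chosen b ++ t))) (has 3 (chosen b ++ t)) b k
  -- The prefix consists of the chosen letters and of t, the rest being s and
  -- the other letters; t and s share the letters 2 and 3.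
  word : ∀ t s → AllPairs _>_ t → All (_≤ 3) t → All (1 <_) t → t ++ 1 ∷ s ↭ 3 ∷ 2 ∷ 1 ∷ [] →
         ∃ λ w → Perm (3 + m) w × (∃ λ k → key m w ≡ prefixKey t k)
  word t s t↘ t≤ 1<t p = D ++ 1 ∷ s ++ others b , downFrom-Perm (↭-trans perm (chosen-others b)) , k , (begin
    key m (D ++ 1 ∷ s ++ others b)                  ≡⟨ cong (keyOf m) (before-++-1 (s ++ others b) 1<D) ⟩
    keyOf m D                                       ≡⟨ keyOf-decreasing m D↘ ⟩
    classify (absent (has 2 D)) (has 3 D) (bits m D) k
      ≡⟨ cong (λ B → classify (absent (has 2 D)) (has 3 D) B k) (bits-chosen b t≤) ⟩
    prefixKey t k                                   ∎)
    where
    open ≡-Reasoning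
    D = chosen b ++ t
    k = (maximum D ∸ 3) mod suc m
    1<D : All (1 <_) D
    1<D = All.++⁺ (All.map (<-trans 1<2 ∘ <-trans 2<3) (3<chosen b)) 1<t
    D↘ : AllPairs _>_ D
    D↘ = AllPairs.++⁺ (chosen-decreasing b) t↘
           (All.map (λ 3<x → All.map (λ y≤3 → ≤-<-trans y≤3 3<x) t≤) (3<chosen b))
    perm : D ++ 1 ∷ s ++ others b ↭ chosen b ++ others b ++ 3 ∷ 2 ∷ 1 ∷ []
    perm = ↭-trans
      (↭-reflexive (trans (++-assoc (chosen b) t _) (cong (chosen b ++_) (sym (++-assoc t (1 ∷ s) (others b))))))
      (++⁺ˡ (chosen b) (↭-trans (++-comm (t ++ 1 ∷ s) (others b)) (++⁺ˡ (others b) p)))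
  has-tail : ∀ {k t} → k ∈ t → has k (chosen b ++ t) ≡ true
  has-tail k∈ = ∈⇒has-true (∈-++⁺ʳ (chosen b) k∈)
  lacks-tail : ∀ {k t} → k ≤ 3 → k ∉ t → has k (chosen b ++ t) ≡ false
  lacks-tail {k} {t} k≤3 k∉ = dec-false (k ∈? (chosen b ++ t)) λ k∈ →
    [ (λ ∈c → <-irrefl refl (<-≤-trans (All.lookup (3<chosen b) ∈c) k≤3)) , k∉ ]′ (∈-++⁻ (chosen b) k∈)
  finish : ∀ {w h₂ h₃ h₂′ h₃′ k} → key m w ≡ classify (absent h₂) h₃ b k → h₂ ≡ h₂′ → h₃ ≡ h₃′ →
           key m w ≡ classify (absent h₂′) h₃′ b k
  finish eq refl refl = eq
  realise : ∀ tag → ∃ λ w → Perm (3 + m) w × key m w ≡ inj₁ (tag , b)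
  realise 0F
    with w , p , _ , eq ← word (3 ∷ 2 ∷ []) [] ((2<3 ∷ []) ∷ [] ∷ []) (≤-refl ∷ <⇒≤ 2<3 ∷ [])
                            (<-trans 1<2 2<3 ∷ 1<2 ∷ []) ↭-refl
    = w , p , finish {w} eq (has-tail (there (here refl))) (has-tail (here refl))
  realise 1F
    with w , p , _ , eq ← word (2 ∷ []) (3 ∷ []) ([] ∷ []) (<⇒≤ 2<3 ∷ []) (1<2 ∷ [])
                            (↭-trans (↭-prep 2 (↭-swap 1 3 ↭-refl)) (↭-swap 2 3 ↭-refl))
    = w , p , finish {w} eq (has-tail (here refl)) (lacks-tail ≤-refl λ { (here ()) })
  realise 2F
    with w , p , _ , eq ← word (3 ∷ []) (2 ∷ []) ([] ∷ []) (≤-refl ∷ []) (<-trans 1<2 2<3 ∷ [])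
                            (↭-prep 3 (↭-swap 1 2 ↭-refl))
    = w , p , finish {w} eq (lacks-tail (<⇒≤ 2<3) λ { (here ()) }) (has-tail (here refl))
key-surjective m (inj₂ zero)    = map suc (upTo (3 + m)) , ↭-refl , refl
-- The one-letter prefix 4 + i.
key-surjective m (inj₂ (suc i))
  with p ← ↭-refl {x = map suc (upTo (3 + m))}
  with Q , q ← extract₂ (λ ()) (Perm⇒∈ p (+-monoʳ-< 3 (toℕ<n i))) (Perm⇒∈ {k = 0} p (s≤s z≤n))
  = 4 + toℕ i ∷ 1 ∷ Q , ↭-sym q
  , trans (keyOf-decreasing m {4 + toℕ i ∷ []} ([] ∷ []))
      (cong inj₂ (toℕ-injective
        (trans (toℕ-fromℕ< (m%n<n (suc (toℕ i)) (suc m))) (m<n⇒m%n≡m (s≤s (toℕ<n i))))))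

------------------------------------------------------------------------
-- The number of keys

uncons↔ : ∀ m → Vec Bool (suc m) ↔ (Bool × Vec Bool m)
uncons↔ m = mk↔ₛ′ uncons (λ (x , b) → x ∷ b) (λ _ → refl) (λ { (_ ∷ _) → refl })

bits↔ : ∀ m → Vec Bool m ↔ Fin (2 ^ m)
bits↔ zero    = mk↔ₛ′ (λ _ → zero) (λ _ → []) (λ { zero → refl }) (λ { [] → refl })
bits↔ (suc m) = Inverse.↔-trans (uncons↔ m)
  (Inverse.↔-trans (Inverse.↔-sym 2↔Bool ×-↔ bits↔ m) (Inverse.↔-sym *↔×))

Key↔ : ∀ m → Key m ↔ Fin (3 * 2 ^ m + suc m)
Key↔ m = Inverse.↔-trans (Inverse.↔-trans (Inverse.↔-refl ×-↔ bits↔ m) (Inverse.↔-sym *↔×) ⊎-↔ Inverse.↔-refl)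
           (Inverse.↔-sym +↔⊎)

------------------------------------------------------------------------
-- Words with the same letters and the same relative order

-- The order condition of IsOrderPermutationOf, for two arbitrary words.
SameOrder : ∀ {c} → Vec ℕ c → Vec ℕ c → Set
SameOrder u v = ∀ i j → (lookup u i < lookup u j) ⇔ (lookup v i < lookup v j)

larger-cong : ∀ {c} (u v : Vec ℕ c) {p q} → (∀ j → (p < lookup u j) ⇔ (q < lookup v j)) →
              larger p (toList u) ≡ larger q (toList v)
larger-cong []      []      eq = refl
larger-cong (x ∷ u) (y ∷ v) {p} {q} eq = cong₂ _+_
  (cong (if_then 1 else 0) (does-⇔ (eq 0F) (p <? x) (q <? y))) (larger-cong u v (eq ∘ suc))

χ-antitone : ∀ {p q} x → p < q → χ q x ≤ χ p x
χ-antitone {p} {q} x p<q with q <? x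
... | yes q<x = ≤-reflexive (trans (χ-yes q<x) (sym (χ-yes (<-trans p<q q<x))))
... | no q≮x  = ≤-trans (≤-reflexive (cong (if_then 1 else 0) (dec-false (q <? x) q≮x))) z≤n

larger-antitone : ∀ {p q} u → p < q → larger q u ≤ larger p u
larger-antitone []      p<q = z≤n
larger-antitone (x ∷ u) p<q = +-mono-≤ (χ-antitone x p<q) (larger-antitone u p<q)

larger-< : ∀ {p q} u → p < q → q ∈ u → larger q u < larger p u
larger-< {p} {q} (x ∷ u) p<q (here refl) = begin-strict
  χ q q + larger q u  ≡⟨ cong (_+ larger q u) (cong (if_then 1 else 0) (dec-false (q <? q) (<-irrefl refl))) ⟩
  larger q u          ≤⟨ larger-antitone u p<q ⟩
  larger p u          <⟨ n<1+n _ ⟩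
  1 + larger p u      ≡⟨ cong (_+ larger p u) (χ-yes p<q) ⟨
  χ p q + larger p u  ∎
  where
  open ≤-Reasoning
larger-< (x ∷ u) p<q (there q∈) = +-mono-≤-< (χ-antitone x p<q) (larger-< u p<q q∈)

lookup∈toList : ∀ {c} (u : Vec ℕ c) i → lookup u i ∈ toList u
lookup∈toList (x ∷ u) zero    = here refl
lookup∈toList (x ∷ u) (suc i) = there (lookup∈toList u i)

-- Corresponding letters have equally many letters above them, hence agree.
SameOrder⇒≡ : ∀ {c} (σ u v : Vec ℕ c) → SameOrder σ u → SameOrder σ v → toList u ↭ toList v → u ≡ v
SameOrder⇒≡ σ u v ou ov p =
  trans (sym (tabulate∘lookup u)) (trans (tabulate-cong pointwise) (tabulate∘lookup v))
  where
  rank≡ : ∀ i → larger (lookup u i) (toList u) ≡ larger (lookup v i) (toList u)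
  rank≡ i = trans (larger-cong u v λ j → ov i j ⇔-∘ ⇔-sym (ou i j)) (larger-↭ (lookup v i) (↭-sym p))
  pointwise : ∀ i → lookup u i ≡ lookup v i
  pointwise i with <-cmp (lookup u i) (lookup v i)
  ... | tri≈ _ eq _ = eq
  ... | tri< lt _ _ = contradiction (sym (rank≡ i))
    (<⇒≢ (larger-< (toList u) lt (∈-resp-↭ (↭-sym p) (lookup∈toList v i))))
  ... | tri> _ _ gt = contradiction (rank≡ i) (<⇒≢ (larger-< (toList u) gt (lookup∈toList u i)))

-- The word whose letter in position i is the letter of u in position s i.
rearrange : ∀ {c} → (Fin c → Fin c) → Vec ℕ c → Vec ℕ c
rearrange s u = tabulate (lookup u ∘ s)

SameOrder-rearrange : ∀ {c} s (σ u : Vec ℕ c) → SameOrder σ u →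
                      SameOrder (rearrange s σ) (rearrange s u)
SameOrder-rearrange s σ u ord i j
  rewrite lookup∘tabulate (lookup σ ∘ s) i | lookup∘tabulate (lookup σ ∘ s) j
        | lookup∘tabulate (lookup u ∘ s) i | lookup∘tabulate (lookup u ∘ s) j = ord (s i) (s j)

------------------------------------------------------------------------
-- The K-equivalence in terms of moves

[123] [132] [231] [312] : Vec ℕ 3
[123] = 1 ∷ 2 ∷ 3 ∷ []
[132] = 1 ∷ 3 ∷ 2 ∷ []
[231] = 2 ∷ 3 ∷ 1 ∷ []
[312] = 3 ∷ 1 ∷ 2 ∷ []

-- The rearrangements of three positions with
--   x y z ↦ x z y,   x y z ↦ y z x,   x y z ↦ z x y.
exchange₂₃ rotateˡ rotateʳ : Fin 3 → Fin 3
exchange₂₃ = λ { 0F → 0F ; 1F → 2F ; 2F → 1F }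
rotateˡ    = λ { 0F → 1F ; 1F → 2F ; 2F → 0F }
rotateʳ    = λ { 0F → 2F ; 1F → 0F ; 2F → 1F }

rotateˡ-↭ : ∀ {x y z : ℕ} → x ∷ y ∷ z ∷ [] ↭ y ∷ z ∷ x ∷ []
rotateˡ-↭ {x} {y} {z} = ↭-trans (↭-swap x y ↭-refl) (↭-prep y (↭-swap x z ↭-refl))

-- The letters of the second window are those of the first, so its order
-- permutation determines it.
window~ : ∀ {σ τ u v : Vec ℕ 3} b → SameOrder σ u → SameOrder τ v → toList u ↭ toList v →
          SamePart K₀ σ τ → toList u ++ b ~ toList v ++ b
window~ {σ} {u = u} {v} b ou ov p (inj₁ refl) with refl ← SameOrder⇒≡ σ u v ou ov p = ε
window~ {u = u} {v} b ou ov p (inj₂ (here (here refl , here refl)))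
  with refl ← SameOrder⇒≡ [123] u v ou ov p = ε
window~ {u = u} {v} b ou ov p (inj₂ (here (there (here refl) , there (here refl))))
  with refl ← SameOrder⇒≡ [132] u v ou ov p = ε
window~ {u = u} {v} b ou ov p (inj₂ (there (here (here refl , here refl))))
  with refl ← SameOrder⇒≡ [231] u v ou ov p = ε
window~ {u = u} {v} b ou ov p (inj₂ (there (here (there (here refl) , there (here refl)))))
  with refl ← SameOrder⇒≡ [312] u v ou ov p = ε
window~ {u = u@(x ∷ y ∷ z ∷ [])} {v} b ou ov p (inj₂ (here (here refl , there (here refl))))
  with refl ← SameOrder⇒≡ [132] (x ∷ z ∷ y ∷ []) v (SameOrder-rearrange exchange₂₃ [123] u ou) ov
                (↭-trans (↭-prep x (↭-swap z y ↭-refl)) p)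
  = swap~ (Equivalence.to (ou 0F 1F) 1<2) (Equivalence.to (ou 1F 2F) 2<3)
window~ {u = u@(x ∷ z ∷ y ∷ [])} {v} b ou ov p (inj₂ (here (there (here refl) , here refl)))
  with refl ← SameOrder⇒≡ [123] (x ∷ y ∷ z ∷ []) v (SameOrder-rearrange exchange₂₃ [132] u ou) ov
                (↭-trans (↭-prep x (↭-swap y z ↭-refl)) p)
  = ~-sym (swap~ (Equivalence.to (ou 0F 2F) 1<2) (Equivalence.to (ou 2F 1F) 2<3))
window~ {u = u@(y ∷ z ∷ x ∷ [])} {v} b ou ov p (inj₂ (there (here (here refl , there (here refl)))))
  with refl ← SameOrder⇒≡ [312] (z ∷ x ∷ y ∷ []) v (SameOrder-rearrange rotateˡ [231] u ou) ov
                (↭-trans (↭-sym rotateˡ-↭) p)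
  = rotate~ (Equivalence.to (ou 2F 0F) 1<2) (Equivalence.to (ou 0F 1F) 2<3)
window~ {u = u@(z ∷ x ∷ y ∷ [])} {v} b ou ov p (inj₂ (there (here (there (here refl) , here refl))))
  with refl ← SameOrder⇒≡ [231] (y ∷ z ∷ x ∷ []) v (SameOrder-rearrange rotateʳ [312] u ou) ov
                (↭-trans rotateˡ-↭ p)
  = ~-sym (rotate~ (Equivalence.to (ou 1F 2F) 1<2) (Equivalence.to (ou 2F 0F) 2<3))

Replacement⇒~ : ∀ {n} {φ ψ : Vec ℕ n} → Replacement K₀ φ ψ → toList φ ~ toList ψ
Replacement⇒~ {φ = φ} {ψ} r = subst₂ _~_ (sym φ≡aub) (sym ψ≡avb)
  (prefix~ a (window~ b (proj₂ σ-ord) (proj₂ τ-ord) u↭v στ∈K))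
  where
  open Replacement r
  u↭v = dropSuffix b (dropPrefix a (↭-trans (↭-reflexive (sym φ≡aub))
         (↭-trans φ-perm (↭-trans (↭-sym ψ-perm) (↭-reflexive ψ≡avb)))))

≈⇒~ : ∀ {n} {φ ψ : Vec ℕ n} → EqClosure (Replacement K₀) φ ψ → toList φ ~ toList ψ
≈⇒~ = EqC.gfold (EqC.isEquivalence Step) toList Replacement⇒~

sorted-order : ∀ {x y z} → x < y → y < z → SameOrder [123] (x ∷ y ∷ z ∷ [])
sorted-order {x} {y} {z} x<y y<z = λ where
    0F 0F → neither (<-irrefl refl) (<-irrefl refl)
    0F 1F → mk⇔ (λ _ → x<y) (λ _ → s≤s (s≤s z≤n))
    0F 2F → mk⇔ (λ _ → <-trans x<y y<z) (λ _ → s≤s (s≤s z≤n))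
    1F 0F → neither (λ { (s≤s ()) }) (<-asym x<y)
    1F 1F → neither (<-irrefl refl) (<-irrefl refl)
    1F 2F → mk⇔ (λ _ → y<z) (λ _ → s≤s (s≤s (s≤s z≤n)))
    2F 0F → neither (λ { (s≤s ()) }) (<-asym (<-trans x<y y<z))
    2F 1F → neither (λ { (s≤s (s≤s ())) }) (<-asym y<z)
    2F 2F → neither (<-irrefl refl) (<-irrefl refl)
  where
  neither : ∀ {A B : Set} → ¬ A → ¬ B → A ⇔ B
  neither ¬a ¬b = mk⇔ (λ a → contradiction a ¬a) (λ b → contradiction b ¬b)

Step⇒Replacement : ∀ {n} {φ ψ : Vec ℕ n} {w w′} → IsPermutation φ → IsPermutation ψ →
                   toList φ ≡ w → toList ψ ≡ w′ → Step w w′ → Replacement K₀ φ ψ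
Step⇒Replacement φp ψp φ≡ ψ≡ (at a (swap {x} {y} {z} b x<y y<z)) = record
  { φ-perm = φp ; ψ-perm = ψp ; a = a ; b = b
  ; u = x ∷ y ∷ z ∷ [] ; v = x ∷ z ∷ y ∷ [] ; φ≡aub = φ≡ ; ψ≡avb = ψ≡
  ; σ = [123] ; τ = [132]
  ; σ-ord = ↭-refl , sorted-order x<y y<z
  ; τ-ord = ↭-prep 1 (↭-swap 3 2 ↭-refl)
          , SameOrder-rearrange exchange₂₃ [123] (x ∷ y ∷ z ∷ []) (sorted-order x<y y<z)
  ; στ∈K = inj₂ (here (here refl , there (here refl))) }
Step⇒Replacement φp ψp φ≡ ψ≡ (at a (rotate {x} {y} {z} b x<y y<z)) = record
  { φ-perm = φp ; ψ-perm = ψp ; a = a ; b = b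
  ; u = y ∷ z ∷ x ∷ [] ; v = z ∷ x ∷ y ∷ [] ; φ≡aub = φ≡ ; ψ≡avb = ψ≡
  ; σ = [231] ; τ = [312]
  ; σ-ord = ↭-sym rotateˡ-↭
          , SameOrder-rearrange rotateˡ [123] (x ∷ y ∷ z ∷ []) (sorted-order x<y y<z)
  ; τ-ord = rotateˡ-↭
          , SameOrder-rearrange rotateʳ [123] (x ∷ y ∷ z ∷ []) (sorted-order x<y y<z)
  ; στ∈K = inj₂ (there (here (here refl , there (here refl)))) }

toVec : ∀ {n} w → length w ≡ n → ∃ λ (φ : Vec ℕ n) → toList φ ≡ w
toVec w refl = fromList w , toList∘fromList w

~⇒≈ : ∀ {n} {φ ψ : Vec ℕ n} {w w′} → IsPermutation φ → IsPermutation ψ →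
      toList φ ≡ w → toList ψ ≡ w′ → w ~ w′ → EqClosure (Replacement K₀) φ ψ
~⇒≈ {φ = φ} {ψ} φp ψp φ≡ ψ≡ ε
  with refl ← trans (sym (cast-is-id refl φ)) (toList-injective refl φ ψ (trans φ≡ (sym ψ≡))) = ε
~⇒≈ {n} {φ} {ψ} {w} φp ψp φ≡ ψ≡ (_◅_ {j = w₁} s rest)
  with q ← ~⇒↭ (s ◅ ε)
  with χ , χ≡ ← toVec {n} w₁ (trans (sym (↭-length q)) (trans (sym (cong length φ≡)) (length-toList φ)))
  with χp ← ↭-trans (↭-reflexive χ≡) (↭-trans (↭-sym q) (↭-trans (↭-reflexive (sym φ≡)) φp))
  = replace s ◅ ~⇒≈ χp ψp χ≡ ψ≡ rest
  where
  replace : SymClosure Step w w₁ → SymClosure (Replacement K₀) φ χ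
  replace (fwd st) = fwd (Step⇒Replacement φp χp φ≡ χ≡ st)
  replace (bwd st) = bwd (Step⇒Replacement χp φp χ≡ φ≡ st)

-- Words in the same class have the same key, words with the same key are
-- equivalent, and every key occurs.
key-bijection : ∀ m → Bijection (K-setoid K₀ (3 + m)) (≡.setoid (Key m))
key-bijection m = record
  { to        = λ (φ , _) → key m (toList φ)
  ; cong      = λ {(φ , φp)} φ≈ψ → key-~ m (Perm⇒Valid {3 + m} φp) (≈⇒~ φ≈ψ)
  ; bijective = (λ {(φ , φp)} {(ψ , ψp)} eq → ~⇒≈ φp ψp refl refl (key-injective {m} φp ψp eq)) , surjective
  }
  where
  surjective : ∀ k → ∃ λ (φ : S (3 + m)) → ∀ {ψ : S (3 + m)} →
               EqClosure (Replacement K₀) (proj₁ ψ) (proj₁ φ) → key m (toList (proj₁ ψ)) ≡ k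
  surjective k with w , p , eq ← key-surjective m k
    with φ , refl ← toVec {3 + m} w (Perm-length p)
    = (φ , p) , λ {(ψ , ψp)} ψ≈φ → trans (key-~ m (Perm⇒Valid {3 + m} ψp) (≈⇒~ ψ≈φ)) eq

------------------------------------------------------------------------
-- The number of classes

proposition3p34 : (n : ℕ) → n ≥ 3 →
    HasNumberOfClasses (K-setoid K₀ n) (3 * 2 ^ (n ∸ 3) + (n ∸ 2))
proposition3p34 (suc (suc (suc m))) (s≤s (s≤s (s≤s z≤n))) = bijection (key-bijection m) (Inverse.↔⇒⤖ (Key↔ m))
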